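{- For every $n>0$, the canonical join complex of the Hochschild lattice $\mathrm{Hoch}(n)$ is vertex decomposable.
   Context: Hochschild lattice. For $n\geq 1$, a triword of length $n$ is a tuple $u=(u_1,\ldots,u_n)$ such that (T1) $u_i\in\{0,1,2\}$ for all $i$; (T2) $u_1\neq 2$; (T3) if $u_i=0$, then $u_j\neq 1$ for all $j>i$. Let $\mathrm{Tri}(n)$ be the set of all triwords of length $n$. The Hochschild lattice is $\mathrm{Hoch}(n)=(\mathrm{Tri}(n),\leq)$ where $\leq$ is the componentwise order. It is known to be a lattice: the join is the componentwise maximum, and the meet is obtained by taking the componentwise minimum and then replacing by $0$ every entry $1$ that has an entry $0$ somewhere to its left. Canonical join complex. Let $L$ be a finite lattice. A join representation of $a\in L$ is a subset $A\subseteq L$ with $\bigvee A=a$ (the empty join is $\hat 0$). For join representations $A_1,A_2$ of $a$, $A_1$ refines $A_2$ if for every $a_1\in A_1$ there is $a_2\in A_2$ with $a_1\leq a_2$. The canonical join representation of $a$ (if it exists) is the antichain which is a join representation of $a$ and refines every join representation of $a$; it consists of join-irreducible elements. It is known that in $\mathrm{Hoch}(n)$ every element has a canonical join representation, and that every subset of a canonical join representation is again a canonical join representation. The canonical join complex of $L$ is the simplicial complex whose vertices are the join-irreducible elements of $L$ and whose faces are the canonical join representations of elements of $L$. Vertex decomposability (not necessarily pure). For a simplicial complex $\Delta$ and a vertex $v$, let $\mathrm{link}_\Delta(v)=\{G\in\Delta\mid v\notin G,\ G\cup\{v\}\in\Delta\}$ and $\mathrm{del}_\Delta(v)=\{G\in\Delta\mid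 v\notin G\}$. Facets are inclusion-maximal faces, and a simplex is a complex with a unique facet. $\Delta$ is vertex decomposable if either $\Delta$ is a simplex, or there exists a vertex $v$ of $\Delta$ such that (VD1) $\mathrm{link}_\Delta(v)$ is vertex decomposable, (VD2) $\mathrm{del}_\Delta(v)$ is vertex decomposable, and (VD3) no facet of $\mathrm{link}_\Delta(v)$ is a facet of $\mathrm{del}_\Delta(v)$. -}

module Defs where

import Algebra.Construct.NaturalChoice.Max as NaturalMax
import Algebra.Construct.NaturalChoice.Min as NaturalMin
open import Data.Fin.Base using (Fin; zero; suc; toℕ; _≤_; _<_)
open import Data.Fin.Patterns using (0F; 1F; 2F)
import Data.Fin.Properties as Fin
open import Data.List.Base using (List; []; _∷_; [_]; _++_; filter; foldr)
open import Data.List.Relation.Unary.All as All using (All; []; _∷_)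
open import Data.List.Relation.Unary.Any as Any using (Any; here; there; any?)
import Data.List.Relation.Unary.Any.Properties as Anyₚ
import Data.List.Membership.Setoid as SetoidMembership
import Data.List.Membership.Setoid.Properties as Membershipₚ
import Data.List.Relation.Binary.Subset.Setoid as SetoidSubset
import Data.List.Relation.Binary.Subset.Setoid.Properties as Subsetₚ
open import Data.Nat.Base as ℕ using (ℕ; z≤n; s≤s)
open import Data.Product.Base using (∃-syntax; _×_; _,_; proj₁)
open import Data.Sum.Base using (_⊎_; inj₁; inj₂; [_,_]′)
open import Data.Vec.Base using (Vec; []; _∷_; lookup; map; zipWith; replicate)
open import Data.Vec.Properties using (lookup-map; lookup-zipWith; lookup-replicate; ≡-dec)
open import Data.Vec.Relation.Binary.Equality.Propositional using (≋⇒≡)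
open import Data.Vec.Relation.Binary.Pointwise.Extensional using (ext; extensional⇒inductive)
open import Function.Base using (_∘_; _∋_)
open import Function.Bundles using (_⇔_; mk⇔)
open import Level using (Level; 0ℓ; _⊔_) renaming (suc to lsuc)
open import Relation.Binary.Bundles using (Setoid)
open import Relation.Binary.Definitions using (Decidable; DecidableEquality)
open import Relation.Binary.Lattice using (BoundedLattice; Supremum; Infimum)
open import Relation.Binary.PropositionalEquality
  using (_≡_; _≢_; refl; sym; trans; cong; isEquivalence)
open import Relation.Binary.Structures using (IsPartialOrder)
open import Relation.Nullary using (¬_; yes; no; contradiction)
open import Relation.Nullary.Decidable using (¬?; map′)
open import Relation.Unary using (Pred)

-- A finite set of elements of S is represented by a list; only membership up
-- to _≈_ matters, so multiplicity and order are irrelevant.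

module Complexes {c ℓ : Level} (S : Setoid c ℓ) where

  open Setoid S using () renaming (Carrier to V)
  open SetoidMembership S using (_∈_; _∉_)
  open SetoidSubset S using (_⊆_)

  -- Closure under _⊆_ also makes Face invariant under equality of sets.
  -- Neither the complex without faces nor the one whose only face is the
  -- empty set is excluded.

  record SimplicialComplex (f : Level) : Set (lsuc (c ⊔ ℓ ⊔ f)) where
    field
      Face       : Pred (List V) (c ⊔ ℓ ⊔ f)
      downClosed : ∀ {F G} → G ⊆ F → Face F → Face G

  module _ {f : Level} (Δ : SimplicialComplex f) where

    open SimplicialComplex Δ

    IsVertex : Pred V (c ⊔ ℓ ⊔ f)
    IsVertex v = Face [ v ]

    IsFacet : Pred (List V) (c ⊔ ℓ ⊔ f)
    IsFacet F = Face F × (∀ G → Face G → F ⊆ G → G ⊆ F)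

    IsSimplex : Set (c ⊔ ℓ ⊔ f)
    IsSimplex = ∃[ F ] IsFacet F × (∀ G → IsFacet G → F ⊆ G × G ⊆ F)

    link : V → SimplicialComplex f
    link v = record
      { Face       = λ G → Face G × v ∉ G × Face (v ∷ G)
      ; downClosed = λ H⊆G (face , v∉G , face∷) →
          downClosed H⊆G face , v∉G ∘ H⊆G , downClosed (Subsetₚ.∷⁺ʳ S v H⊆G) face∷
      }

    del : V → SimplicialComplex f
    del v = record
      { Face       = λ G → Face G × v ∉ G
      ; downClosed = λ H⊆G (face , v∉G) → downClosed H⊆G face , v∉G ∘ H⊆G
      }

  data VertexDecomposable {f : Level} (Δ : SimplicialComplex f) : Set (c ⊔ ℓ ⊔ f) where
    simplex : IsSimplex Δ → VertexDecomposable Δ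
    shed    : ∀ v → IsVertex Δ v →
              VertexDecomposable (link Δ v) →
              VertexDecomposable (del Δ v) →
              (∀ G → IsFacet (link Δ v) G → ¬ IsFacet (del Δ v) G) →
              VertexDecomposable Δ

-- Meant for finite lattices, where lists represent all subsets and a lattice
-- is automatically bounded.

module CanonicalJoins {c ℓ₁ ℓ₂ : Level} (L : BoundedLattice c ℓ₁ ℓ₂) where

  open BoundedLattice L
    using (_≈_; _∨_; ⊥; setoid; antisym; minimum; x≤x∨y; y≤x∨y; ∨-least; module Eq)
    renaming ( Carrier to A; _≤_ to _⊑_; refl to ⊑-refl; reflexive to ⊑-reflexive
             ; trans to ⊑-trans; ≤-respʳ-≈ to ⊑-respʳ-≈; ≤-respˡ-≈ to ⊑-respˡ-≈)
  open SetoidMembership setoid using (_∈_; _∉_; find)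
  open SetoidSubset setoid using (_⊆_)
  open Complexes setoid

  JoinIrreducible : Pred A (c ⊔ ℓ₁)
  JoinIrreducible j = ¬ (j ≈ ⊥) × (∀ a b → j ≈ a ∨ b → j ≈ a ⊎ j ≈ b)

  ⋁ : List A → A
  ⋁ = foldr _∨_ ⊥

  _JoinRepresents_ : List A → A → Set ℓ₁
  B JoinRepresents a = ⋁ B ≈ a

  _Refines_ : List A → List A → Set (c ⊔ ℓ₂)
  B₁ Refines B₂ = All (λ b₁ → Any (b₁ ⊑_) B₂) B₁

  IsAntichain : Pred (List A) (c ⊔ ℓ₁ ⊔ ℓ₂)
  IsAntichain B = ∀ {x y} → x ∈ B → y ∈ B → x ⊑ y → x ≈ y

  record IsCanonicalJoinRep (B : List A) (a : A) : Set (c ⊔ ℓ₁ ⊔ ℓ₂) where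
    field
      antichain  : IsAntichain B
      represents : B JoinRepresents a
      refines    : ∀ C → C JoinRepresents a → B Refines C

  private
    upper : ∀ {x} B → x ∈ B → x ⊑ ⋁ B
    upper (b ∷ B) (here x≈b)  = ⊑-trans (⊑-reflexive x≈b) (x≤x∨y b (⋁ B))
    upper (b ∷ B) (there x∈B) = ⊑-trans (upper B x∈B) (y≤x∨y b (⋁ B))

    least : ∀ {z} B → (∀ {x} → x ∈ B → x ⊑ z) → ⋁ B ⊑ z
    least []      _ = minimum _
    least (b ∷ B) h = ∨-least (h (here Eq.refl)) (least B (h ∘ there))

    singleton-≈ : ∀ j → ⋁ [ j ] ≈ j
    singleton-≈ j = antisym (∨-least ⊑-refl (minimum j)) (x≤x∨y j ⊥)

    irreducible-∈ : ∀ {j} → JoinIrreducible j → ∀ B → j ≈ ⋁ B → j ∈ B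
    irreducible-∈ (j≉⊥ , _) []      j≈⊥ = contradiction j≈⊥ j≉⊥
    irreducible-∈ J@(_ , s) (b ∷ B) eq  =
      [ here , there ∘ irreducible-∈ J B ]′ (s b (⋁ B) eq)

  -- A subset B of the canonical join representation F of a canonically
  -- represents its own join: if ⋁ C ≈ ⋁ B, then C ∪ (F ∖ B) represents a, so
  -- every b ∈ B lies below some element of it, which is in C as F is an
  -- antichain.

  module _ (_≟_ : Decidable _≈_) where

    private
      subset : ∀ {a B F} → B ⊆ F → IsCanonicalJoinRep F a → IsCanonicalJoinRep B (⋁ B)
      subset {a} {B} {F} B⊆F F-canonical = record
        { antichain  = λ x∈B y∈B → F.antichain (B⊆F x∈B) (B⊆F y∈B)
        ; represents = Eq.refl
        ; refines    = λ C C≈B → All.tabulateₛ setoid (below C C≈B)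
        }
        where
        module F = IsCanonicalJoinRep F-canonical

        ∉B? = λ x → ¬? (any? (x ≟_) B)

        resp : ∀ {x y} → x ≈ y → x ∉ B → y ∉ B
        resp x≈y x∉B y∈B = x∉B (Membershipₚ.∈-resp-≈ setoid (Eq.sym x≈y) y∈B)

        rest = filter ∉B? F

        below : ∀ C → ⋁ C ≈ ⋁ B → ∀ {b} → b ∈ B → Any (b ⊑_) C
        below C C≈B {b} b∈B = pick (Anyₚ.++⁻ C (All.lookupₛ setoid respAny (F.refines (C ++ rest) C+rest≈a) (B⊆F b∈B)))
          where
          respAny : ∀ {x y} → x ≈ y → Any (x ⊑_) (C ++ rest) → Any (y ⊑_) (C ++ rest)
          respAny x≈y = Any.map (⊑-respˡ-≈ x≈y)

          F⊑ : ∀ {x} → x ∈ F → x ⊑ ⋁ (C ++ rest)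
          F⊑ {x} x∈F with any? (x ≟_) B
          ... | yes x∈B = ⊑-trans (upper B x∈B) (⊑-trans (⊑-reflexive (Eq.sym C≈B))
                            (least C (upper (C ++ rest) ∘ Membershipₚ.∈-++⁺ˡ setoid)))
          ... | no  x∉B = upper (C ++ rest)
                            (Membershipₚ.∈-++⁺ʳ setoid C (Membershipₚ.∈-filter⁺ setoid ∉B? resp x∈F x∉B))

          ⊑F : ∀ {x} → x ∈ C ++ rest → x ⊑ ⋁ F
          ⊑F x∈ with Membershipₚ.∈-++⁻ setoid C x∈
          ... | inj₁ x∈C = ⊑-trans (upper C x∈C) (⊑-trans (⊑-reflexive C≈B) (least B (upper F ∘ B⊆F)))
          ... | inj₂ x∈r = upper F (proj₁ (Membershipₚ.∈-filter⁻ setoid ∉B? resp x∈r))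

          C+rest≈a : ⋁ (C ++ rest) ≈ a
          C+rest≈a = Eq.trans (antisym (least (C ++ rest) ⊑F) (least F F⊑)) F.represents

          pick : Any (b ⊑_) C ⊎ Any (b ⊑_) rest → Any (b ⊑_) C
          pick (inj₁ b⊑C) = b⊑C
          pick (inj₂ b⊑r) with find b⊑r
          ... | x , x∈r , b⊑x with Membershipₚ.∈-filter⁻ setoid ∉B? resp x∈r
          ... | x∈F , x∉B = contradiction (Membershipₚ.∈-resp-≈ setoid (F.antichain (B⊆F b∈B) x∈F b⊑x) b∈B) x∉B

    canonicalJoinComplex : SimplicialComplex ℓ₂
    canonicalJoinComplex = record
      { Face       = λ B → ∃[ a ] IsCanonicalJoinRep B a
      ; downClosed = λ {_} {G} G⊆F (_ , F-canonical) → ⋁ G , subset G⊆F F-canonical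
      }

    vertex⇔joinIrreducible : ∀ j → IsVertex canonicalJoinComplex j ⇔ JoinIrreducible j
    vertex⇔joinIrreducible j = mk⇔ to from
      where
      to : IsVertex canonicalJoinComplex j → JoinIrreducible j
      to (a , canonical) = j≉⊥ , split
        where
        open IsCanonicalJoinRep canonical

        j≈a : j ≈ a
        j≈a = Eq.trans (Eq.sym (singleton-≈ j)) represents

        j≉⊥ : ¬ (j ≈ ⊥)
        j≉⊥ j≈⊥ with refines [] (Eq.trans (Eq.sym j≈⊥) j≈a)
        ... | () ∷ []

        split : ∀ x y → j ≈ x ∨ y → j ≈ x ⊎ j ≈ y
        split x y eq with refines (x ∷ y ∷ []) (Eq.trans (antisym
                            (∨-least (x≤x∨y x y) (∨-least (y≤x∨y x y) (minimum _)))
                            (∨-least (x≤x∨y x _) (⊑-trans (x≤x∨y y ⊥) (y≤x∨y x _))))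
                            (Eq.trans (Eq.sym eq) j≈a))
        ... | here j⊑x         ∷ [] = inj₁ (antisym j⊑x (⊑-respʳ-≈ (Eq.sym eq) (x≤x∨y x y)))
        ... | there (here j⊑y) ∷ [] = inj₂ (antisym j⊑y (⊑-respʳ-≈ (Eq.sym eq) (y≤x∨y x y)))

      from : JoinIrreducible j → IsVertex canonicalJoinComplex j
      from J = j , record
        { antichain  = λ where (here x≈j) (here y≈j) _ → Eq.trans x≈j (Eq.sym y≈j)
        ; represents = singleton-≈ j
        ; refines    = λ C C≈j → Any.map ⊑-reflexive (irreducible-∈ J C (Eq.sym C≈j)) ∷ []
        }

open NaturalMax (Fin.≤-totalOrder 3) using (x≤x⊔y; x≤y⊔x; ⊔-lub; ⊔-sel) renaming (_⊔_ to max)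
open NaturalMin (Fin.≤-totalOrder 3) using (x⊓y≤x; x⊓y≤y; ⊓-glb) renaming (_⊓_ to min)

-- The negations in the last two fields are definitionally proof irrelevant,
-- so triwords are propositionally equal as soon as their words are. The first
-- letter u₁ is the one at index 0.

record Triword (n : ℕ) : Set where
  constructor triword
  field
    word    : Vec (Fin 3) n
    first≢2 : ∀ i → toℕ i ≡ 0 → lookup word i ≢ 2F
    no-01   : ∀ i j → i < j → lookup word i ≡ 0F → lookup word j ≢ 1F

open Triword

infix 4 _≼_ _≟_

_≼_ : ∀ {n} → Triword n → Triword n → Set
u ≼ v = ∀ i → lookup (word u) i ≤ lookup (word v) i

_≟_ : ∀ {n} → DecidableEquality (Triword n)
u ≟ v = map′ (λ { refl → refl }) (cong word) (≡-dec Fin._≟_ (word u) (word v))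

private
  lower≢2 : {x y : Fin 3} → x ≤ y → y ≢ 2F → x ≢ 2F
  lower≢2 {y = 0F} ()       _   refl
  lower≢2 {y = 1F} (s≤s ()) _   refl
  lower≢2 {y = 2F} _        y≢2 refl = y≢2 refl

  lower-0 : {x y : Fin 3} → x ≤ y → y ≡ 0F → x ≡ 0F
  lower-0 {0F} _  refl = refl
  lower-0 {suc _} () refl

  max≢ : ∀ {k} (x y : Fin 3) → x ≢ k → y ≢ k → max x y ≢ k
  max≢ x y x≢k y≢k eq with ⊔-sel x y
  ... | inj₁ ≡x = x≢k (trans (sym ≡x) eq)
  ... | inj₂ ≡y = y≢k (trans (sym ≡y) eq)

  ≼-isPartialOrder : ∀ {n} → IsPartialOrder (_≡_ {A = Triword n}) _≼_
  ≼-isPartialOrder = record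
    { isPreorder = record
      { isEquivalence = isEquivalence
      ; reflexive     = λ { refl _ → Fin.≤-refl }
      ; trans         = λ u≼v v≼w i → Fin.≤-trans (u≼v i) (v≼w i)
      }
    ; antisym = λ {u} {v} u≼v v≼u → word-injective {u = u} {v}
        (≋⇒≡ (extensional⇒inductive (ext λ i → Fin.≤-antisym (u≼v i) (v≼u i))))
    }
    where
    word-injective : ∀ {n} {u v : Triword n} → word u ≡ word v → u ≡ v
    word-injective refl = refl

infixr 6 _∨_
infixr 7 _∧_

_∨_ : ∀ {n} → Triword n → Triword n → Triword n
word    (u ∨ v) = zipWith max (word u) (word v)
first≢2 (u ∨ v) i i≡0 rewrite lookup-zipWith max i (word u) (word v) =
  max≢ _ _ (first≢2 u i i≡0) (first≢2 v i i≡0)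
no-01   (u ∨ v) i j i<j uᵢ∨vᵢ≡0
  rewrite lookup-zipWith max i (word u) (word v)
        | lookup-zipWith max j (word u) (word v) =
  max≢ _ _ (no-01 u i j i<j (lower-0 (x≤x⊔y (lookup (word u) i) (lookup (word v) i)) uᵢ∨vᵢ≡0))
           (no-01 v i j i<j (lower-0 (x≤y⊔x (lookup (word u) i) (lookup (word v) i)) uᵢ∨vᵢ≡0))

1↦0 : Fin 3 → Fin 3
1↦0 0F = 0F
1↦0 1F = 0F
1↦0 2F = 2F

-- Replaces by 0 every entry 1 that has an entry 0 somewhere to its left.

clear : ∀ {n} → Vec (Fin 3) n → Vec (Fin 3) n
clear []               = []
clear (0F ∷ xs)        = 0F ∷ map 1↦0 xs
clear (x@(suc _) ∷ xs) = x ∷ clear xs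

private
  1↦0-≤ : ∀ x → 1↦0 x ≤ x
  1↦0-≤ 0F = z≤n
  1↦0-≤ 1F = z≤n
  1↦0-≤ 2F = Fin.≤-refl {x = Fin 3 ∋ 2F}

  1↦0-≢1 : ∀ x → 1↦0 x ≢ 1F
  1↦0-≢1 0F ()
  1↦0-≢1 1F ()
  1↦0-≢1 2F ()

  1↦0-glb : {x y : Fin 3} → x ≢ 1F → x ≤ y → x ≤ 1↦0 y
  1↦0-glb {0F}      _   _   = z≤n
  1↦0-glb {1F}      x≢1 _   = contradiction refl x≢1
  1↦0-glb {2F} {1F} _   (s≤s ())
  1↦0-glb {2F} {2F} _   x≤y = x≤y

  clear-≤ : ∀ {n} (xs : Vec (Fin 3) n) i → lookup (clear xs) i ≤ lookup xs i
  clear-≤ (0F ∷ xs)    zero    = z≤n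
  clear-≤ (0F ∷ xs)    (suc i) rewrite lookup-map i 1↦0 xs = 1↦0-≤ (lookup xs i)
  clear-≤ (suc _ ∷ xs) zero    = Fin.≤-refl
  clear-≤ (suc _ ∷ xs) (suc i) = clear-≤ xs i

  clear-no-01 : ∀ {n} (xs : Vec (Fin 3) n) i j → i < j →
                lookup (clear xs) i ≡ 0F → lookup (clear xs) j ≢ 1F
  clear-no-01 (0F ∷ xs)    _       (suc j) _         _ rewrite lookup-map j 1↦0 xs = 1↦0-≢1 (lookup xs j)
  clear-no-01 (suc _ ∷ xs) (suc i) (suc j) (s≤s i<j) = clear-no-01 xs i j i<j

  clear-glb : ∀ {n} (ws xs : Vec (Fin 3) n) →
              (∀ i j → i < j → lookup ws i ≡ 0F → lookup ws j ≢ 1F) →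
              (∀ i → lookup ws i ≤ lookup xs i) → ∀ i → lookup ws i ≤ lookup (clear xs) i
  clear-glb (w ∷ ws) (0F ∷ xs)    _     ws≤xs zero    = ws≤xs zero
  clear-glb (w ∷ ws) (0F ∷ xs)    no-01 ws≤xs (suc i) rewrite lookup-map i 1↦0 xs =
    1↦0-glb (no-01 zero (suc i) (s≤s z≤n) (lower-0 (ws≤xs zero) refl)) (ws≤xs (suc i))
  clear-glb (w ∷ ws) (suc _ ∷ xs) _     ws≤xs zero    = ws≤xs zero
  clear-glb (w ∷ ws) (suc _ ∷ xs) no-01 ws≤xs (suc i) =
    clear-glb ws xs (λ i j i<j → no-01 (suc i) (suc j) (s≤s i<j)) (ws≤xs ∘ suc) i

  min-≤ˡ : ∀ {n} (xs ys : Vec (Fin 3) n) i → lookup (zipWith min xs ys) i ≤ lookup xs i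
  min-≤ˡ xs ys i rewrite lookup-zipWith min i xs ys = x⊓y≤x (lookup xs i) (lookup ys i)

  min-≤ʳ : ∀ {n} (xs ys : Vec (Fin 3) n) i → lookup (zipWith min xs ys) i ≤ lookup ys i
  min-≤ʳ xs ys i rewrite lookup-zipWith min i xs ys = x⊓y≤y (lookup xs i) (lookup ys i)

_∧_ : ∀ {n} → Triword n → Triword n → Triword n
word    (u ∧ v) = clear (zipWith min (word u) (word v))
first≢2 (u ∧ v) i i≡0 =
  lower≢2 (Fin.≤-trans (clear-≤ (zipWith min (word u) (word v)) i) (min-≤ˡ (word u) (word v) i)) (first≢2 u i i≡0)
no-01   (u ∧ v) = clear-no-01 (zipWith min (word u) (word v))

bottom : ∀ {n} → Triword n
word    bottom = replicate _ 0F
first≢2 bottom i _ rewrite lookup-replicate i (Fin 3 ∋ 0F) = λ ()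
no-01   bottom _ j _ _ rewrite lookup-replicate j (Fin 3 ∋ 0F) = λ ()

topWord : ∀ n → Vec (Fin 3) n
topWord ℕ.zero    = []
topWord (ℕ.suc n) = 1F ∷ replicate n 2F

private
  topWord-first≢2 : ∀ n i → toℕ i ≡ 0 → lookup (topWord n) i ≢ 2F
  topWord-first≢2 (ℕ.suc n) zero _ ()

  topWord-no-01 : ∀ n i j → i < j → lookup (topWord n) i ≡ 0F → lookup (topWord n) j ≢ 1F
  topWord-no-01 (ℕ.suc n) _ (suc j) _ _ rewrite lookup-replicate j (Fin 3 ∋ 2F) = λ ()

top : ∀ {n} → Triword n
top {n} = triword (topWord n) (topWord-first≢2 n) (topWord-no-01 n)

private
  supremum : ∀ {n} → Supremum (_≼_ {n}) _∨_
  supremum u v = (λ i → ≤ˡ i) , (λ i → ≤ʳ i) , λ w u≼w v≼w i → lub w i (u≼w i) (v≼w i)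
    where
    ≤ˡ : ∀ i → lookup (word u) i ≤ lookup (word (u ∨ v)) i
    ≤ˡ i rewrite lookup-zipWith max i (word u) (word v) = x≤x⊔y (lookup (word u) i) (lookup (word v) i)

    ≤ʳ : ∀ i → lookup (word v) i ≤ lookup (word (u ∨ v)) i
    ≤ʳ i rewrite lookup-zipWith max i (word u) (word v) = x≤y⊔x (lookup (word u) i) (lookup (word v) i)

    lub : ∀ w i → lookup (word u) i ≤ lookup (word w) i → lookup (word v) i ≤ lookup (word w) i →
          lookup (word (u ∨ v)) i ≤ lookup (word w) i
    lub w i rewrite lookup-zipWith max i (word u) (word v) = ⊔-lub

  infimum : ∀ {n} → Infimum (_≼_ {n}) _∧_
  infimum u v =
      (λ i → Fin.≤-trans (clear-≤ u⊓v i) (min-≤ˡ (word u) (word v) i))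
    , (λ i → Fin.≤-trans (clear-≤ u⊓v i) (min-≤ʳ (word u) (word v) i))
    , λ w w≼u w≼v → clear-glb (word w) u⊓v (no-01 w) (λ i → glb w i (w≼u i) (w≼v i))
    where
    u⊓v = zipWith min (word u) (word v)

    glb : ∀ w i → lookup (word w) i ≤ lookup (word u) i → lookup (word w) i ≤ lookup (word v) i →
          lookup (word w) i ≤ lookup u⊓v i
    glb w i rewrite lookup-zipWith min i (word u) (word v) = ⊓-glb

  maximum : ∀ {n} (u : Triword n) → u ≼ top
  maximum {ℕ.suc n} u zero    with lookup (word u) zero in eq
  ... | 0F = z≤n
  ... | 1F = Fin.≤-refl {x = Fin 3 ∋ 1F}
  ... | 2F = contradiction eq (first≢2 u zero refl)
  maximum {ℕ.suc n} u (suc i) rewrite lookup-replicate i (Fin 3 ∋ 2F) = Fin.≤fromℕ (lookup (word u) (suc i))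

  minimum : ∀ {n} (u : Triword n) → bottom ≼ u
  minimum u i rewrite lookup-replicate i (Fin 3 ∋ 0F) = z≤n

Hoch : ℕ → BoundedLattice 0ℓ 0ℓ 0ℓ
Hoch n = record
  { Carrier          = Triword n
  ; _≈_              = _≡_
  ; _≤_              = _≼_
  ; _∨_              = _∨_
  ; _∧_              = _∧_
  ; ⊤                = top
  ; ⊥                = bottom
  ; isBoundedLattice = record
    { isLattice = record
      { isPartialOrder = ≼-isPartialOrder
      ; supremum       = supremum
      ; infimum        = infimum
      }
    ; maximum = maximum
    ; minimum = minimum
    }
  }

{-# OPTIONS --safe #-}

-- The join-irreducibles of Hoch(n) are the words 1ᵏ0ⁿ⁻ᵏ for 1 ≤ k ≤ n and the
-- words with a single nonzero entry, a 2 that is not in first place. The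
-- canonical joinands of u are the words of the second kind for the entries 2
-- of u and, if u has an entry 1, the word 1ᵏ0ⁿ⁻ᵏ for the last such entry uₖ.
-- So the facets are, for each k, 1ᵏ0ⁿ⁻ᵏ together with all words of the second
-- kind that do not have their 2 in place k. The complex is thus a simplex F₀
-- (k = 1) with a cone attached along a proper face of F₀ for each k ≥ 2, and
-- the apexes of these cones can be shed one after the other.

module Submission where

open import Defs
open import Data.Nat.Base using (ℕ; _>_)
open import Relation.Binary.Lattice using (BoundedLattice)
open Complexes using (VertexDecomposable)
open CanonicalJoins using (canonicalJoinComplex)

import Algebra.Construct.NaturalChoice.Max as NaturalMax
open import Data.Fin.Base using (Fin; zero; suc; _≤_; _<_)
open import Data.Fin.Patterns using (0F; 1F; 2F)
import Data.Fin.Properties as Fin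
open import Data.List.Base using (List; []; _∷_; _++_; map; filter; allFin)
import Data.List.Membership.Propositional as Membership
open import Data.List.Membership.Propositional.Properties
  using (∈-map⁺; ∈-map⁻; ∈-filter⁺; ∈-filter⁻; ∈-allFin; ∈-++⁺ˡ; ∈-++⁺ʳ; ∈-++⁻)
import Data.List.Membership.Setoid as SetoidMembership
import Data.List.Membership.Setoid.Properties as SetoidMembershipₚ
import Data.List.Relation.Binary.Subset.Setoid as SetoidSubset
import Data.List.Relation.Unary.All as All
open import Data.List.Relation.Unary.Any as Any using (Any; here; there)
open import Data.Nat.Base as ℕ using (z≤n; s≤s)
import Data.Nat.Properties as ℕₚ
open import Data.Product.Base using (∃-syntax; _×_; _,_; proj₂)
open import Data.Sum.Base using (_⊎_; inj₁; inj₂)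
open import Data.Vec.Base using (Vec; lookup; tabulate; _[_]≔_)
open import Data.Vec.Properties
  using (lookup∘tabulate; lookup-replicate; lookup-zipWith; lookup∘updateAt; lookup∘updateAt′)
open import Function.Base using (_∘_; _∋_)
open import Function.Bundles using (_⇔_; mk⇔; Equivalence)
open import Function.Definitions using (Injective)
open import Level using (Level)
open import Relation.Binary.Bundles using (Setoid)
open import Relation.Binary.Definitions using (tri<; tri≈; tri>)
open import Relation.Binary.PropositionalEquality
  using (_≡_; _≢_; refl; sym; trans; cong; subst)
open import Relation.Nullary using (¬_; yes; no; contradiction)
open import Relation.Nullary.Decidable using (¬?; _×-dec_; _→-dec_)
open import Relation.Unary using (Pred; Decidable)

open Triword

-- Vertex decomposability of a simplex with cones attached.

module _ {c ℓ : Level} (S : Setoid c ℓ) where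

  open Setoid S using (_≈_) renaming (Carrier to V; refl to ≈-refl)
  open SetoidMembership S using (_∈_; _∉_)
  open SetoidSubset S using (_⊆_)
  open Complexes S using (SimplicialComplex; IsSimplex; link; del; simplex; shed)
  open SimplicialComplex using (Face)

  generated-simplex : ∀ {f} (Δ : SimplicialComplex f) F → Face Δ F →
                      (∀ {G} → Face Δ G → G ⊆ F) → IsSimplex Δ
  generated-simplex Δ F F-face below-F =
    F , (F-face , λ G G-face _ → below-F G-face) , unique
    where
    unique : ∀ G → _ → F ⊆ G × G ⊆ F
    unique G (G-face , maximal) = maximal F F-face (below-F G-face) , below-F G-face

  drop-head : ∀ {v G H} → v ∉ G → G ⊆ v ∷ H → G ⊆ H
  drop-head v∉G G⊆vH x∈G with G⊆vH x∈G
  ... | here x≈v  = contradiction (SetoidMembershipₚ.∈-resp-≈ S x≈v x∈G) v∉G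
  ... | there x∈H = x∈H

  -- Induction on the number of cones, shedding the apex `v zero`: its link is the simplex on
  -- `H zero`, and its deletion has the same form with one cone fewer. Describing `Δ` only through
  -- its faces lets the induction hypothesis apply to `del Δ w` as it stands.
  cones-vertexDecomposable :
    ∀ {m f} (F₀ : List V) (v : Fin m → V) (H : Fin m → List V) →
    Injective _≡_ _≈_ v → (∀ k → v k ∉ F₀) → (∀ k → H k ⊆ F₀) → (∀ k → ¬ (F₀ ⊆ H k)) →
    (Δ : SimplicialComplex f) →
    (∀ {G} → Face Δ G ⇔ (G ⊆ F₀ ⊎ ∃[ k ] G ⊆ v k ∷ H k)) →
    VertexDecomposable S Δ
  cones-vertexDecomposable {ℕ.zero} F₀ v H v-inj v∉F₀ H⊆F₀ F₀⊈H Δ face⇔ =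
    simplex (generated-simplex Δ F₀ (from face⇔ (inj₁ λ x∈F₀ → x∈F₀)) (below ∘ to face⇔))
    where
    open Equivalence
    below : ∀ {G} → (G ⊆ F₀ ⊎ ∃[ k ] G ⊆ v k ∷ H k) → G ⊆ F₀
    below (inj₁ G⊆F₀) = G⊆F₀
  cones-vertexDecomposable {ℕ.suc m} F₀ v H v-inj v∉F₀ H⊆F₀ F₀⊈H Δ face⇔ =
    shed w (from face⇔ (inj₂ (zero , λ { (here x≈w) → here x≈w })))
      (simplex (generated-simplex (link Δ w) (H zero)
        (base-face , w∉H zero , from face⇔ (inj₂ (zero , λ x∈ → x∈))) link-below))
      (cones-vertexDecomposable F₀ (v ∘ suc) (H ∘ suc)
        (Fin.suc-injective ∘ v-inj) (v∉F₀ ∘ suc) (H⊆F₀ ∘ suc) (F₀⊈H ∘ suc)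
        (del Δ w) (mk⇔ del-to del-from))
      -- A facet `G` of the link lies in `H zero`, hence in `F₀`, which is a face of the deletion.
      -- Were `G` a facet there too, maximality would give `F₀ ⊆ G ⊆ H zero`.
      (λ G (G-face , _) (_ , maximal) → F₀⊈H zero (link-below G-face ∘
        maximal F₀ (from face⇔ (inj₁ λ x∈ → x∈) , v∉F₀ zero)
          (H⊆F₀ zero ∘ link-below G-face)))
    where
    open Equivalence

    w = v zero

    w∉H : ∀ k → w ∉ H k
    w∉H k = v∉F₀ zero ∘ H⊆F₀ k

    base-face : Face Δ (H zero)
    base-face = from face⇔ (inj₁ (H⊆F₀ zero))

    w∉cone : ∀ k → w ∉ v (suc k) ∷ H (suc k)
    w∉cone k (here w≈v)  = contradiction (v-inj w≈v) λ ()
    w∉cone k (there w∈H) = w∉H (suc k) w∈H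

    link-below : ∀ {G} → Face (link Δ w) G → G ⊆ H zero
    link-below (_ , w∉G , wG-face) with to face⇔ wG-face
    ... | inj₁ wG⊆F₀          = contradiction (wG⊆F₀ (here ≈-refl)) (v∉F₀ zero)
    ... | inj₂ (zero  , wG⊆)  = drop-head w∉G (wG⊆ ∘ there)
    ... | inj₂ (suc k , wG⊆)  = contradiction (wG⊆ (here ≈-refl)) (w∉cone k)

    del-to : ∀ {G} → Face (del Δ w) G → G ⊆ F₀ ⊎ ∃[ k ] G ⊆ v (suc k) ∷ H (suc k)
    del-to (G-face , w∉G) with to face⇔ G-face
    ... | inj₁ G⊆F₀         = inj₁ G⊆F₀
    -- A face of the first cone that omits the apex falls back into `F₀`.
    ... | inj₂ (zero  , G⊆) = inj₁ (H⊆F₀ zero ∘ drop-head w∉G G⊆)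
    ... | inj₂ (suc k , G⊆) = inj₂ (k , G⊆)

    del-from : ∀ {G} → (G ⊆ F₀ ⊎ ∃[ k ] G ⊆ v (suc k) ∷ H (suc k)) → Face (del Δ w) G
    del-from (inj₁ G⊆F₀)     = from face⇔ (inj₁ G⊆F₀) , v∉F₀ zero ∘ G⊆F₀
    del-from (inj₂ (k , G⊆)) = from face⇔ (inj₂ (suc k , G⊆)) , w∉cone k ∘ G⊆

-- Joins of lists, and last witnesses of decidable predicates.

module _ {c ℓ₁ ℓ₂ : Level} (L : BoundedLattice c ℓ₁ ℓ₂) where

  open BoundedLattice L using (setoid; reflexive; minimum; x≤x∨y; y≤x∨y; ∨-least)
    renaming (_≤_ to _⊑_; trans to ⊑-trans; module Eq to ≈)
  open SetoidMembership setoid using (_∈_)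
  open CanonicalJoins L using (⋁)

  ⋁-upper : ∀ {x} B → x ∈ B → x ⊑ ⋁ B
  ⋁-upper (b ∷ B) (here x≈b)  = ⊑-trans (reflexive x≈b) (x≤x∨y b (⋁ B))
  ⋁-upper (b ∷ B) (there x∈B) = ⊑-trans (⋁-upper B x∈B) (y≤x∨y b (⋁ B))

  ⋁-least : ∀ {z} B → (∀ {x} → x ∈ B → x ⊑ z) → ⋁ B ⊑ z
  ⋁-least []      _     = minimum _
  ⋁-least (b ∷ B) below = ∨-least (below (here ≈.refl)) (⋁-least B (below ∘ there))

-- Later indices are searched first, so `zero` is returned only when they all fail.
last : ∀ {n p} {P : Pred (Fin n) p} → Decidable P → ∃[ i ] P i →
       ∃[ k ] P k × (∀ j → k < j → ¬ P j)
last {ℕ.suc n} P? (i , Pi) with Fin.any? (P? ∘ suc)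
... | yes later = let k , Pk , none-after = last (P? ∘ suc) later in
  suc k , Pk , λ { (suc j) (s≤s k<j) → none-after j k<j }
last {ℕ.suc n} P? (zero  , P0) | no none = zero , P0 , λ { (suc j) _ Pj → none (j , Pj) }
last {ℕ.suc n} P? (suc i , Pi) | no none = contradiction (i , Pi) none

-- The two families of join-irreducible triwords.

module _ {m : ℕ} where

  private
    n = ℕ.suc m
    L = Hoch n

  open BoundedLattice L using (antisym)
  open CanonicalJoins L using (⋁; IsCanonicalJoinRep; IsAntichain)
  open Complexes.SimplicialComplex (canonicalJoinComplex L _≟_) using (Face; downClosed)
  open Membership {A = Triword n} using (_∈_; _∉_)
  open SetoidSubset (BoundedLattice.setoid L) using (_⊆_)
  open NaturalMax (Fin.≤-totalOrder 3) using (⊔-sel) renaming (_⊔_ to max)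

  infix 9 _‼_
  _‼_ : Triword n → Fin n → Fin 3
  u ‼ i = lookup (word u) i

  -- With places counted from 0, `initial k` has `k + 1` letters 1, so even `initial zero` differs
  -- from `bottom`.
  initialLetter : Fin n → Fin n → Fin 3
  initialLetter k i with i Fin.≤? k
  ... | yes _ = 1F
  ... | no  _ = 0F

  initialLetter-≤ : ∀ {k i} → i ≤ k → initialLetter k i ≡ 1F
  initialLetter-≤ {k} {i} i≤k with i Fin.≤? k
  ... | yes _   = refl
  ... | no  i≰k = contradiction i≤k i≰k

  initialLetter-1 : ∀ {k i} → initialLetter k i ≡ 1F → i ≤ k
  initialLetter-1 {k} {i} eq with i Fin.≤? k
  initialLetter-1 eq | yes i≤k = i≤k
  initialLetter-1 () | no  _

  initialLetter≢2 : ∀ k i → initialLetter k i ≢ 2F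
  initialLetter≢2 k i with i Fin.≤? k
  ... | yes _ = λ ()
  ... | no  _ = λ ()

  initial : Fin n → Triword n
  word    (initial k) = tabulate (initialLetter k)
  first≢2 (initial k) i _ rewrite lookup∘tabulate (initialLetter k) i = initialLetter≢2 k i
  no-01   (initial k) i j i<j
    rewrite lookup∘tabulate (initialLetter k) i | lookup∘tabulate (initialLetter k) j =
    λ 0≡ 1≡ → contradiction
      (trans (sym 0≡) (initialLetter-≤ (Fin.≤-trans (ℕₚ.<⇒≤ i<j) (initialLetter-1 1≡)))) λ ()

  initial-‼ : ∀ k i → initial k ‼ i ≡ initialLetter k i
  initial-‼ k = lookup∘tabulate (initialLetter k)

  bottom-‼ : ∀ i → bottom ‼ i ≡ 0F
  bottom-‼ i = lookup-replicate i (Fin 3 ∋ 0F)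

  -- The 2 stands in place `suc i`, so `Fin m` indexes exactly the places where (T2) permits a 2.
  single-word : Fin m → Vec (Fin 3) n
  single-word i = word bottom [ suc i ]≔ 2F

  single-here : ∀ i → lookup (single-word i) (suc i) ≡ 2F
  single-here i = lookup∘updateAt (suc i) (word bottom)

  single-elsewhere : ∀ i j → j ≢ suc i → lookup (single-word i) j ≡ 0F
  single-elsewhere i j j≢ = trans (lookup∘updateAt′ j (suc i) j≢ (word bottom)) (bottom-‼ j)

  single : Fin m → Triword n
  word    (single i) = single-word i
  first≢2 (single i) zero _ ()
  no-01   (single i) _ j _ _ 1≡ with j Fin.≟ suc i
  ... | yes refl = contradiction (trans (sym 1≡) (single-here i)) λ ()
  ... | no  j≢   = contradiction (trans (sym 1≡) (single-elsewhere i j j≢)) λ ()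

  -- By (T3) a letter 1 has no 0 to its left, so the one letter at `k` controls the whole prefix.
  initial-≼ : ∀ {u k} → u ‼ k ≡ 1F → initial k ≼ u
  initial-≼ {u} {k} uₖ≡1 i rewrite initial-‼ k i with i Fin.≤? k
  ... | no  _   = z≤n
  ... | yes i≤k with u ‼ i in eq
  ...   | suc _ = s≤s z≤n
  ...   | 0F with Fin.<-cmp i k
  ...     | tri< i<k _ _ = contradiction uₖ≡1 (no-01 u i k i<k eq)
  ...     | tri≈ _ refl _ = contradiction (trans (sym eq) uₖ≡1) λ ()
  ...     | tri> _ _ k<i = contradiction i≤k (ℕₚ.<⇒≱ k<i)

  single-≼ : ∀ {u i} → u ‼ suc i ≡ 2F → single i ≼ u
  single-≼ {u} {i} uᵢ≡2 j with j Fin.≟ suc i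
  ... | yes refl rewrite uᵢ≡2 | single-here i = Fin.≤-refl {x = Fin 3 ∋ 2F}
  ... | no  j≢   rewrite single-elsewhere i j j≢ = z≤n

  initial-reflects-≤ : ∀ {k l} → initial k ≼ initial l → k ≤ l
  initial-reflects-≤ {k} {l} le with le k
  ... | leₖ rewrite initial-‼ k k | initial-‼ l k | initialLetter-≤ {k} {k} Fin.≤-refl
    with k Fin.≤? l
  ...   | yes k≤l = k≤l
  initial-reflects-≤ le | () | no _

  initial-injective : Injective _≡_ _≡_ initial
  initial-injective {k} {l} eq = Fin.≤-antisym
    (initial-reflects-≤ (λ i → Fin.≤-reflexive (cong (_‼ i) eq)))
    (initial-reflects-≤ (λ i → Fin.≤-reflexive (cong (_‼ i) (sym eq))))

  -- Place `zero` decides: `initial k` has a 1 there and `single i` a 0.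
  initial⋠single : ∀ {k i} → ¬ (initial k ≼ single i)
  initial⋠single {k} le with le zero
  ... | le₀ rewrite initialLetter-≤ {k} {zero} z≤n with le₀
  ...   | ()

  single⋠initial : ∀ {k i} → ¬ (single i ≼ initial k)
  single⋠initial {k} {i} le with le (suc i)
  ... | leᵢ rewrite single-here i | initial-‼ k (suc i) with suc i Fin.≤? k
  single⋠initial le | s≤s () | yes _
  single⋠initial le | ()     | no _

  single-≼⇒≡ : ∀ {i j} → single i ≼ single j → i ≡ j
  single-≼⇒≡ {i} {j} le with i Fin.≟ j
  ... | yes i≡j = i≡j
  ... | no  i≢j with le (suc i)
  ...   | leᵢ rewrite single-here i | single-elsewhere j (suc i) (i≢j ∘ Fin.suc-injective) with leᵢ
  ...     | ()

  initial≢single : ∀ {k i} → initial k ≢ single i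
  initial≢single eq = initial⋠single (λ i → Fin.≤-reflexive (cong (_‼ i) eq))

  -- Canonical join representations of triwords.

  IsLastOne : Triword n → Pred (Fin n) _
  IsLastOne u k = u ‼ k ≡ 1F × (∀ j → k < j → u ‼ j ≢ 1F)

  isLastOne? : ∀ u → Decidable (IsLastOne u)
  isLastOne? u k = (u ‼ k Fin.≟ 1F) ×-dec
    Fin.all? (λ j → (k Fin.<? j) →-dec ¬? (u ‼ j Fin.≟ 1F))

  lastOne-unique : ∀ {u k l} → IsLastOne u k → IsLastOne u l → k ≡ l
  lastOne-unique {k = k} {l} (uₖ≡1 , afterₖ) (uₗ≡1 , afterₗ) with Fin.<-cmp k l
  ... | tri< k<l _ _ = contradiction uₗ≡1 (afterₖ l k<l)
  ... | tri≈ _ k≡l _ = k≡l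
  ... | tri> _ _ l<k = contradiction uₖ≡1 (afterₗ k l<k)

  isTwo? : ∀ u → Decidable (λ i → u ‼ suc i ≡ 2F)
  isTwo? u i = u ‼ suc i Fin.≟ 2F

  -- The first filter keeps at most one index, and none if `u` has no 1. The words `initial j` for
  -- earlier entries 1 lie below the one kept and would spoil the antichain.
  joinands : Triword n → List (Triword n)
  joinands u = map initial (filter (isLastOne? u) (allFin n))
            ++ map single (filter (isTwo? u) (allFin m))

  -- Membership in `joinands u` as an indexed family, so that matching reveals the form of the
  -- element.
  data Joinand (u : Triword n) : Triword n → Set where
    one : ∀ {k} → IsLastOne u k → Joinand u (initial k)
    two : ∀ {i} → u ‼ suc i ≡ 2F → Joinand u (single i)

  ∈-joinands⁺ : ∀ {u x} → Joinand u x → x ∈ joinands u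
  ∈-joinands⁺ {u} (one {k} last-one) =
    ∈-++⁺ˡ (∈-map⁺ initial (∈-filter⁺ (isLastOne? u) (∈-allFin k) last-one))
  ∈-joinands⁺ {u} (two {i} uᵢ≡2) =
    ∈-++⁺ʳ _ (∈-map⁺ single (∈-filter⁺ (isTwo? u) (∈-allFin i) uᵢ≡2))

  ∈-joinands⁻ : ∀ {u x} → x ∈ joinands u → Joinand u x
  ∈-joinands⁻ {u} x∈ with ∈-++⁻ (map initial (filter (isLastOne? u) (allFin n))) x∈
  ... | inj₁ x∈ˡ with ∈-map⁻ initial x∈ˡ
  ...   | k , k∈ , refl = one (proj₂ (∈-filter⁻ (isLastOne? u) {xs = allFin n} k∈))
  ∈-joinands⁻ {u} x∈ | inj₂ x∈ʳ with ∈-map⁻ single x∈ʳ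
  ...   | i , i∈ , refl = two (proj₂ (∈-filter⁻ (isTwo? u) {xs = allFin m} i∈))

  joinand-≼ : ∀ {u x} → Joinand u x → x ≼ u
  joinand-≼ {u} (one (uₖ≡1 , _)) = initial-≼ {u} uₖ≡1
  joinand-≼ {u} (two uᵢ≡2)       = single-≼ {u} uᵢ≡2

  joinands-antichain : ∀ u → IsAntichain (joinands u)
  joinands-antichain u x∈ y∈ x≼y = compare (∈-joinands⁻ x∈) (∈-joinands⁻ y∈) x≼y
    where
    compare : ∀ {x y} → Joinand u x → Joinand u y → x ≼ y → x ≡ y
    compare (one k)     (one l)     _   = cong initial (lastOne-unique {u} k l)
    compare (one {k} _) (two {i} _) x≼y = contradiction x≼y (initial⋠single {k} {i})
    compare (two {i} _) (one {k} _) x≼y = contradiction x≼y (single⋠initial {k} {i})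
    compare (two _)     (two _)     x≼y = cong single (single-≼⇒≡ x≼y)

  -- A 2 is supplied by the `single` for its place, a 1 by `initial k` for the last entry 1, whose
  -- place satisfies `i ≤ k`.
  joinands-cover : ∀ u i → u ‼ i ≢ 0F → ∃[ x ] Joinand u x × x ‼ i ≡ u ‼ i
  joinands-cover u i uᵢ≢0 with u ‼ i in eq
  joinands-cover u i       uᵢ≢0 | 0F = contradiction refl uᵢ≢0
  joinands-cover u zero    uᵢ≢0 | 2F = contradiction eq (first≢2 u zero refl)
  joinands-cover u (suc i) uᵢ≢0 | 2F = single i , two eq , single-here i
  joinands-cover u i       uᵢ≢0 | 1F with last (λ j → u ‼ j Fin.≟ 1F) (i , eq)
  ... | k , last-one@(_ , after) = initial k , one last-one ,
        trans (initial-‼ k i) (initialLetter-≤ (ℕₚ.≮⇒≥ λ k<i → after i k<i eq))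

  joinands-represents : ∀ u → ⋁ (joinands u) ≡ u
  joinands-represents u = antisym
    (⋁-least L {u} (joinands u) (λ x∈ → joinand-≼ (∈-joinands⁻ {u} x∈))) above
    where
    above : u ≼ ⋁ (joinands u)
    above i with u ‼ i Fin.≟ 0F
    ... | yes uᵢ≡0 rewrite uᵢ≡0 = z≤n
    ... | no  uᵢ≢0 with joinands-cover u i uᵢ≢0
    ...   | x , joinand , eq =
      subst (_≤ ⋁ (joinands u) ‼ i) eq (⋁-upper L (joinands u) (∈-joinands⁺ joinand) i)

  -- Joins are componentwise maxima in a chain, so each letter comes from some member. The exception
  -- is a 0, which the empty join also produces.
  ⋁-attained : ∀ {x i} C → ⋁ C ‼ i ≡ x → x ≢ 0F → Any (λ c → c ‼ i ≡ x) C
  ⋁-attained {i = i} []      eq x≢0 = contradiction (trans (sym eq) (bottom-‼ i)) x≢0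
  ⋁-attained {i = i} (c ∷ C) eq x≢0
    rewrite lookup-zipWith max i (word c) (word (⋁ C))
    with ⊔-sel (c ‼ i) (⋁ C ‼ i)
  ... | inj₁ ≡c = here (trans (sym ≡c) eq)
  ... | inj₂ ≡C = there (⋁-attained C (trans (sym ≡C) eq) x≢0)

  -- A joinand is forced by a single letter of `u`. Some member of `C` carries that same letter in
  -- that place, and so lies above the joinand.
  joinand-below : ∀ {u x} → Joinand u x → ∀ C → ⋁ C ≡ u → Any (x ≼_) C
  joinand-below (one (uₖ≡1 , _)) C refl =
    Any.map (λ {c} → initial-≼ {c}) (⋁-attained C uₖ≡1 λ ())
  joinand-below (two uᵢ≡2)       C refl =
    Any.map (λ {c} → single-≼ {c}) (⋁-attained C uᵢ≡2 λ ())

  joinands-canonical : ∀ u → IsCanonicalJoinRep (joinands u) u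
  joinands-canonical u = record
    { antichain  = joinands-antichain u
    ; represents = joinands-represents u
    ; refines    = λ C C≡u → All.tabulate λ x∈ → joinand-below (∈-joinands⁻ {u} x∈) C C≡u
    }

  -- `B` and `joinands u` refine each other: `x ≼ y ≼ z` with `x` and `z` in the antichain `B` and
  -- `y` a joinand, so all three coincide.
  canonical-⊆-joinands : ∀ {B u} → IsCanonicalJoinRep B u → B ⊆ joinands u
  canonical-⊆-joinands {B} {u} canonical {x} x∈B
    with Membership.find (All.lookup (refines (joinands u) (joinands-represents u)) x∈B)
    where open IsCanonicalJoinRep canonical
  ... | y , y∈ , x≼y
    with Membership.find (joinand-below (∈-joinands⁻ {u} y∈) B (IsCanonicalJoinRep.represents canonical))
  ... | z , z∈B , y≼z = subst (_∈ joinands u) (antisym y≼x x≼y) y∈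
    where
    x≡z : x ≡ z
    x≡z = IsCanonicalJoinRep.antichain canonical x∈B z∈B
            (λ i → Fin.≤-trans (x≼y i) (y≼z i))

    y≼x : y ≼ x
    y≼x = subst (y ≼_) (sym x≡z) y≼z

  -- The facets of the canonical join complex.

  singlesAvoiding : Fin n → List (Triword n)
  singlesAvoiding k = map single (filter (λ i → ¬? (suc i Fin.≟ k)) (allFin m))

  -- Place `k` is to carry the last 1, so it cannot carry a 2. For `k = zero` this excludes nothing,
  -- and every `single` occurs.
  facet : Fin n → List (Triword n)
  facet k = initial k ∷ singlesAvoiding k

  ∈-singlesAvoiding⁺ : ∀ {k i} → suc i ≢ k → single i ∈ singlesAvoiding k
  ∈-singlesAvoiding⁺ {k} {i} i≢k =
    ∈-map⁺ single (∈-filter⁺ (λ j → ¬? (suc j Fin.≟ k)) (∈-allFin i) i≢k)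

  ∈-singlesAvoiding⁻ : ∀ {k x} → x ∈ singlesAvoiding k → ∃[ i ] suc i ≢ k × x ≡ single i
  ∈-singlesAvoiding⁻ {k} x∈ with ∈-map⁻ single x∈
  ... | i , i∈ , x≡ = i , proj₂ (∈-filter⁻ (λ j → ¬? (suc j Fin.≟ k)) {xs = allFin m} i∈) , x≡

  initial∉singlesAvoiding : ∀ {k l} → initial k ∉ singlesAvoiding l
  initial∉singlesAvoiding x∈ with ∈-singlesAvoiding⁻ x∈
  ... | _ , _ , eq = initial≢single eq

  joinands-⊆-facet : ∀ u → ∃[ k ] joinands u ⊆ facet k
  joinands-⊆-facet u with Fin.any? (isLastOne? u)
  ... | yes (k , last-one@(uₖ≡1 , _)) = k , λ x∈ → in-facet (∈-joinands⁻ x∈)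
    where
    in-facet : ∀ {x} → Joinand u x → x ∈ facet k
    in-facet (one last-one′) = here (cong initial (lastOne-unique {u} last-one′ last-one))
    in-facet (two uᵢ≡2)      = there (∈-singlesAvoiding⁺ λ { refl →
      contradiction (trans (sym uₖ≡1) uᵢ≡2) λ () })
  -- A word without 1 has only `single` joinands, and `facet zero` contains all of those.
  ... | no none = zero , λ x∈ → in-facet (∈-joinands⁻ x∈)
    where
    in-facet : ∀ {x} → Joinand u x → x ∈ facet zero
    in-facet (one {k} last-one) = contradiction (k , last-one) none
    in-facet (two _)            = there (∈-singlesAvoiding⁺ λ ())

  -- The top word 12...2 with a 1 put in place `k`, which leaves it unchanged for `k = zero`. It has
  -- no 0, and its last 1 is in place `k`.
  facetJoin-word : Fin n → Vec (Fin 3) n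
  facetJoin-word k = word top [ k ]≔ 1F

  facetJoin-here : ∀ k → lookup (facetJoin-word k) k ≡ 1F
  facetJoin-here k = lookup∘updateAt k (word top)

  facetJoin-elsewhere : ∀ k i → suc i ≢ k → lookup (facetJoin-word k) (suc i) ≡ 2F
  facetJoin-elsewhere k i i≢k =
    trans (lookup∘updateAt′ (suc i) k i≢k (word top)) (lookup-replicate i (Fin 3 ∋ 2F))

  facetJoin : Fin n → Triword n
  word    (facetJoin k) = facetJoin-word k
  first≢2 (facetJoin zero)    zero _ ()
  first≢2 (facetJoin (suc k)) zero _ ()
  no-01   (facetJoin k) i _ _ 0≡ with i Fin.≟ k
  ... | yes refl = contradiction (trans (sym 0≡) (facetJoin-here k)) λ ()
  no-01   (facetJoin zero)    zero _ _ () | no _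
  no-01   (facetJoin (suc k)) zero _ _ () | no _
  no-01   (facetJoin k) (suc i) _ _ 0≡ | no i≢k =
    contradiction (trans (sym 0≡) (facetJoin-elsewhere k i i≢k)) λ ()

  facetJoin-lastOne : ∀ k → IsLastOne (facetJoin k) k
  facetJoin-lastOne k = facetJoin-here k , after
    where
    after : ∀ j → k < j → facetJoin k ‼ j ≢ 1F
    after (suc j) k<j 1≡ =
      contradiction (trans (sym 1≡) (facetJoin-elsewhere k j (Fin.<⇒≢ k<j ∘ sym))) λ ()

  facet-⊆-joinands : ∀ k → facet k ⊆ joinands (facetJoin k)
  facet-⊆-joinands k (here refl) = ∈-joinands⁺ {facetJoin k} (one (facetJoin-lastOne k))
  facet-⊆-joinands k (there x∈) with ∈-singlesAvoiding⁻ {k} x∈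
  ... | i , i≢k , refl = ∈-joinands⁺ {facetJoin k} (two (facetJoin-elsewhere k i i≢k))

  face⇒⊆-facet : ∀ {B} → Face B → ∃[ k ] B ⊆ facet k
  face⇒⊆-facet (u , canonical) =
    let k , joinands⊆ = joinands-⊆-facet u in
    k , joinands⊆ ∘ canonical-⊆-joinands canonical

  -- Faces are closed under inclusion, so it is enough that `facet k` lies in the canonical
  -- representation of `facetJoin k`.
  facet-face : ∀ k → Face (facet k)
  facet-face k = downClosed (facet-⊆-joinands k) (_ , joinands-canonical (facetJoin k))

  canonicalJoinComplex-vertexDecomposable :
    VertexDecomposable (BoundedLattice.setoid L) (canonicalJoinComplex L _≟_)
  canonicalJoinComplex-vertexDecomposable =
    cones-vertexDecomposable (BoundedLattice.setoid L)
      (facet zero) (initial ∘ suc) (singlesAvoiding ∘ suc)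
      (λ {k} {l} → Fin.suc-injective ∘ initial-injective {suc k} {suc l})
      -- Each cone is attached along a proper face: `initial zero` belongs to `facet zero` but is no
      -- `single`.
      apex∉base base-⊆ (λ k base⊆ → initial∉singlesAvoiding {zero} {suc k} (base⊆ (here refl)))
      (canonicalJoinComplex L _≟_) (mk⇔ (split ∘ face⇒⊆-facet) unsplit)
    where
    apex∉base : ∀ k → initial (suc k) ∉ facet zero
    apex∉base k (here eq)  = contradiction (initial-injective {suc k} {zero} eq) λ ()
    apex∉base k (there x∈) = initial∉singlesAvoiding {suc k} {zero} x∈

    base-⊆ : ∀ k → singlesAvoiding (suc k) ⊆ facet zero
    base-⊆ k x∈ with ∈-singlesAvoiding⁻ {suc k} x∈
    -- The place `suc i` of a 2 is never `zero`, so no `single` is missing from the base.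
    ... | i , _ , refl = there (∈-singlesAvoiding⁺ λ ())

    split : ∀ {B} → ∃[ k ] B ⊆ facet k → B ⊆ facet zero ⊎ ∃[ k ] B ⊆ facet (suc k)
    split (zero  , B⊆) = inj₁ B⊆
    split (suc k , B⊆) = inj₂ (k , B⊆)

    unsplit : ∀ {B} → B ⊆ facet zero ⊎ ∃[ k ] B ⊆ facet (suc k) → Face B
    unsplit (inj₁ B⊆)       = downClosed B⊆ (facet-face zero)
    unsplit (inj₂ (k , B⊆)) = downClosed B⊆ (facet-face (suc k))

theorem1p2 : ∀ (n : ℕ) → n > 0 →
    VertexDecomposable (BoundedLattice.setoid (Hoch n)) (canonicalJoinComplex (Hoch n) _≟_)
theorem1p2 (ℕ.suc m) _ = canonicalJoinComplex-vertexDecomposable
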